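{- $\tau_E(\mathcal{NC}_n^2) = \frac{n^2}{8} + \Theta(n)$; that is, there exist constants $c_1, c_2 > 0$ such that for all sufficiently large $n$, $\frac{n^2}{8} + c_1 n \le \tau_E(\mathcal{NC}_n^2) \le \frac{n^2}{8} + c_2 n$.
   Context: Let $\mathcal{F}$ be a hypergraph whose vertex set is $E(K_n)$, the edge set of the complete graph on $n$ vertices; its hyperedges are called losing sets. In the unbiased Avoider-Enforcer game on $\mathcal{F}$, two players, Avoider and Enforcer, alternately claim previously unclaimed edges of $K_n$, one edge per turn, with Avoider going first, until all edges are claimed. Enforcer wins if the set of edges claimed by Avoider contains some hyperedge of $\mathcal{F}$; otherwise Avoider wins. $\tau_E(\mathcal{F})$ denotes the smallest integer $t$ such that Enforcer has a strategy guaranteeing that, whatever Avoider does, Avoider's graph contains a hyperedge of $\mathcal{F}$ after at most $t$ moves (rounds); $\tau_E(\mathcal{F})=\infty$ if Avoider wins. $\mathcal{NC}_n^2$ is the hypergraph on $E(K_n)$ whose hyperedges are the edge sets of all non-bipartite graphs on the vertex set of $K_n$; thus Avoider loses as soon as his graph contains an odd cycle. -}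

module Defs where

open import Data.Nat using (ℕ; zero; suc; _+_; _*_; _≤_; _<_)
open import Data.Fin using (Fin) renaming (_<_ to _<ᶠ_)
open import Data.Bool using (Bool)
open import Data.List using (List; []; _∷_)
open import Data.List.Relation.Unary.All using (All)
open import Data.List.Relation.Unary.Any using (Any)
open import Data.Product using (Σ; ∃; _×_; _,_)
open import Relation.Nullary using (¬_)
open import Relation.Binary.PropositionalEquality using (_≡_; _≢_)

record Edge (n : ℕ) : Set where
  constructor edge
  field
    u   : Fin n
    v   : Fin n
    u<v : u <ᶠ v
open Edge public

SameEdge : ∀ {n} → Edge n → Edge n → Set
SameEdge e f = (u e ≡ u f) × (v e ≡ v f)

Free : ∀ {n} → Edge n → List (Edge n) → List (Edge n) → Set
Free e A B = ¬ Any (SameEdge e) A × ¬ Any (SameEdge e) B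

Bipartite : ∀ {n} → List (Edge n) → Set
Bipartite {n} A = Σ (Fin n → Bool) λ c → All (λ e → c (u e) ≢ c (v e)) A

-- Avoider's graph contains a hyperedge of NC_n^2 iff it is non-bipartite.
NonBipartite : ∀ {n} → List (Edge n) → Set
NonBipartite A = ¬ Bipartite A

-- Game positions: A = Avoider's claimed edges, B = Enforcer's claimed edges.
-- AvTurn n k A B : it is Avoider's turn, and Enforcer can force Avoider's graph
--   to become non-bipartite while Avoider makes at most k further moves.
-- EnTurn n k A B : same, but it is Enforcer's turn.
-- The game ends when no unclaimed edge remains; then only the "lost" rule applies.
mutual
  data AvTurn (n : ℕ) : ℕ → List (Edge n) → List (Edge n) → Set where
    av-lost : ∀ {k A B} → NonBipartite A → AvTurn n k A B
    av-move : ∀ {k A B} →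
      Σ (Edge n) (λ e → Free e A B) →                       -- game not over
      (∀ (e : Edge n) → Free e A B → EnTurn n k (e ∷ A) B) →
      AvTurn n (suc k) A B

  data EnTurn (n : ℕ) : ℕ → List (Edge n) → List (Edge n) → Set where
    en-lost : ∀ {k A B} → NonBipartite A → EnTurn n k A B
    en-move : ∀ {k A B} (e : Edge n) → Free e A B → AvTurn n k A (e ∷ B) → EnTurn n k A B

-- Enforcer has a strategy in the unbiased game on NC_n^2 (Avoider first) that makes
-- Avoider's graph non-bipartite after at most t Avoider moves, i.e. τ_E(NC_n^2) ≤ t.
EnforcerWinsWithin : ℕ → ℕ → Set
EnforcerWinsWithin n t = AvTurn n t [] []

{-# OPTIONS --safe #-}
module Submission where

-- Lower bound. While at least three vertices are unmatched, Avoider can extend a matching so that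
-- after his move every Enforcer edge meets it. Swapping the two ends of each matching edge at
-- random gives balanced cuts containing the matching, and each Enforcer edge misses such a cut
-- with probability 1/2; so after about n/2 rounds some balanced cut, of size about n²/4, contains
-- the matching and at most half of Enforcer's edges. Avoider then claims only edges of this cut:
-- the linearly many edges Enforcer wasted outside it delay his loss by linearly many rounds.
--
-- Upper bound. Enforcer claims an edge joining opposite colour classes of one component of
-- Avoider's graph whenever one is free, and any edge otherwise. After a move of the second kind
-- Avoider must merge two components or close an odd cycle, so there are at most n of them.
-- The remaining edges of both players lie in a common cut, which has at most n²/4 edges.

open import Defs
open import Data.Bool using (Bool; true; false; not; if_then_else_; _xor_; _∨_)
open import Data.Bool.Properties using (not-injective; ∨-zeroʳ) renaming (_≟_ to _≟ᵇ_)
open import Data.Empty using (⊥-elim)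
open import Data.Fin using (Fin; zero; suc) renaming (_<_ to _<ᶠ_)
open import Data.Fin.Properties using (_≟_; suc-injective; <-irrelevant; <⇒≢; <-cmp; <-asym)
open import Data.List using (List; []; _∷_; _++_; map; length; allFin)
open import Data.List.Properties using (map-++; map-∘; map-tabulate; map-cong; length-tabulate)
open import Data.List.Membership.Propositional using (_∈_; _∉_; find; lose)
open import Data.List.Membership.Propositional.Properties using (∈-allFin; ∈-map⁺; ∈-map⁻; ∈-++⁺ˡ; ∈-++⁺ʳ; ∈-++⁻; ∈-∃++)
open import Data.List.Relation.Binary.Permutation.Propositional
  using (_↭_; ↭-refl; ↭-sym; ↭-trans; ↭-prep; ↭-swap; ↭⇒↭ₛ)
open import Data.List.Relation.Binary.Permutation.Propositional.Properties
  using (∈-resp-↭; ↭-length; shift; ++⁺ˡ) renaming (map⁺ to ↭-map⁺)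
import Data.List.Relation.Binary.Permutation.Setoid.Properties as Permutationₛ
open import Data.List.Relation.Unary.All using (All; []; _∷_)
import Data.List.Relation.Unary.All as All
open import Data.List.Relation.Unary.Any using (Any; here; there; any?; satisfied)
import Data.List.Relation.Unary.Any as Any
open import Data.List.Relation.Unary.AllPairs using ([]; _∷_)
open import Data.List.Relation.Unary.Unique.Propositional using (Unique)
open import Data.List.Relation.Unary.Unique.Propositional.Properties using (map⁺; ++⁺; allFin⁺)
open import Data.Nat using (ℕ; zero; suc; _+_; _*_; _/_; _%_; _≤_; _<_; z≤n; s≤s)
open import Data.Nat.DivMod using (m/n*n≤m; m%n<n; m≡m%n+[m/n]*n)
open import Data.Nat.ListAction using (sum)
open import Data.Nat.ListAction.Properties using (sum-++; sum-↭)
open import Data.Nat.Properties hiding (_≟_; suc-injective; <-irrelevant; <⇒≢; <-cmp; <-asym)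
open import Data.Nat.Tactic.RingSolver using (solve-∀)
open import Data.Product using (∃; ∃-syntax; _×_; _,_; proj₁; proj₂)
open import Data.Sum using (_⊎_; inj₁; inj₂)
open import Data.Unit using (tt)
open import Function using (_∘_)
open import Relation.Binary.Definitions using (tri<; tri≈; tri>)
open import Relation.Binary.PropositionalEquality
open import Relation.Nullary using (¬_; Dec; yes; no; does)
open import Relation.Nullary.Decidable using (¬?; _×-dec_; dec-true; dec-false)
open import Relation.Unary using (Decidable)

variable
  n : ℕ
  X : Set
  P Q R : Set

-- Sums of indicators over lists.

ind : Dec P → ℕ
ind (yes _) = 1
ind (no _)  = 0

ind-mono : (p : Dec P) (q : Dec Q) → (P → Q) → ind p ≤ ind q
ind-mono (yes _) (yes _) _ = ≤-refl
ind-mono (yes p) (no ¬q) f = ⊥-elim (¬q (f p))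
ind-mono (no _)  _       _ = z≤n

ind-⊎ : (p : Dec P) (q : Dec Q) (r : Dec R) → (P → Q ⊎ R) → ind p ≤ ind q + ind r
ind-⊎ (no _)  _       _       _ = z≤n
ind-⊎ (yes _) (yes _) _       _ = s≤s z≤n
ind-⊎ (yes _) (no _)  (yes _) _ = ≤-refl
ind-⊎ (yes p) (no ¬q) (no ¬r) f with f p
... | inj₁ q = ⊥-elim (¬q q)
... | inj₂ r = ⊥-elim (¬r r)

ind-disjoint : (p : Dec P) (q : Dec Q) (r : Dec R) →
  (P → R) → (Q → R) → (P → ¬ Q) → ind p + ind q ≤ ind r
ind-disjoint (no _)  q       r _ g _ = ind-mono q r g
ind-disjoint (yes p) (yes q) _ _ _ d = ⊥-elim (d p q)
ind-disjoint (yes p) (no _)  r f _ _ = ind-mono (yes p) r f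

∑ : (X → ℕ) → List X → ℕ
∑ f xs = sum (map f xs)

module _ {f g : X → ℕ} where

  ∑-mono : (∀ x → f x ≤ g x) → ∀ xs → ∑ f xs ≤ ∑ g xs
  ∑-mono f≤g []       = z≤n
  ∑-mono f≤g (x ∷ xs) = +-mono-≤ (f≤g x) (∑-mono f≤g xs)

  ∑-cong : (∀ x → f x ≡ g x) → ∀ xs → ∑ f xs ≡ ∑ g xs
  ∑-cong f≡g xs = cong sum (map-cong f≡g xs)

  ∑-+ : ∀ xs → ∑ (λ x → f x + g x) xs ≡ ∑ f xs + ∑ g xs
  ∑-+ []       = refl
  ∑-+ (x ∷ xs) rewrite ∑-+ xs = exchange (f x) (g x) (∑ f xs) (∑ g xs)
    where
    exchange : ∀ a b c d → a + b + (c + d) ≡ a + c + (b + d)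
    exchange = solve-∀

module _ {f g h : X → ℕ} where

  ∑-≤+ : (∀ x → f x ≤ g x + h x) → ∀ xs → ∑ f xs ≤ ∑ g xs + ∑ h xs
  ∑-≤+ f≤g+h xs = ≤-trans (∑-mono f≤g+h xs) (≤-reflexive (∑-+ xs))

  ∑-+≤ : (∀ x → f x + g x ≤ h x) → ∀ xs → ∑ f xs + ∑ g xs ≤ ∑ h xs
  ∑-+≤ f+g≤h xs = ≤-trans (≤-reflexive (sym (∑-+ xs))) (∑-mono f+g≤h xs)

∑-one : (xs : List X) → ∑ (λ _ → 1) xs ≡ length xs
∑-one []       = refl
∑-one (x ∷ xs) = cong suc (∑-one xs)

∑-++ : (f : X → ℕ) (xs ys : List X) → ∑ f (xs ++ ys) ≡ ∑ f xs + ∑ f ys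
∑-++ f xs ys = trans (cong sum (map-++ f xs ys)) (sum-++ (map f xs) (map f ys))

∑-map : {Y : Set} (f : Y → ℕ) (g : X → Y) (xs : List X) → ∑ f (map g xs) ≡ ∑ (f ∘ g) xs
∑-map f g xs = cong sum (sym (map-∘ xs))

module _ {P : X → Set} (P? : Decidable P) where

  ∑-ind-none : ∀ {xs} → All (λ x → ¬ P x) xs → ∑ (ind ∘ P?) xs ≡ 0
  ∑-ind-none []                     = refl
  ∑-ind-none {x ∷ _} (¬px ∷ ¬pxs) with P? x
  ... | yes px = ⊥-elim (¬px px)
  ... | no _   = ∑-ind-none ¬pxs

  ∑-ind-single : ∀ {x xs} → P x → (∀ {y} → P y → x ≡ y) → Unique xs → x ∈ xs → ∑ (ind ∘ P?) xs ≡ 1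
  ∑-ind-single {x} px only (x∉ ∷ uniq) (here refl) with P? x
  ... | no ¬px = ⊥-elim (¬px px)
  ... | yes _  = cong suc (∑-ind-none (All.map (λ x≢y py → x≢y (only py)) x∉))
  ∑-ind-single {x} px only (_∷_ {y} y∉ uniq) (there x∈) with P? y
  ... | yes py = ⊥-elim (All.lookup y∉ x∈ (sym (only py)))
  ... | no _   = ∑-ind-single px only uniq x∈

allFin-suc : ∀ n → allFin (suc n) ≡ zero ∷ map suc (allFin n)
allFin-suc n = cong (zero ∷_) (sym (map-tabulate (λ i → i) suc))

-- Edges of the complete graph and counting them.

SameEdge⇒≡ : {e f : Edge n} → SameEdge e f → e ≡ f
SameEdge⇒≡ {e = edge x y p} {edge .x .y q} (refl , refl) = cong (edge x y) (<-irrelevant p q)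

_≟ᵉ_ : (e f : Edge n) → Dec (e ≡ f)
e ≟ᵉ f with u e ≟ u f | v e ≟ v f
... | yes p | yes q = yes (SameEdge⇒≡ (p , q))
... | no ¬p | _     = no λ { refl → ¬p refl }
... | _     | no ¬q = no λ { refl → ¬q refl }

_∈?_ : (e : Edge n) (A : List (Edge n)) → Dec (e ∈ A)
e ∈? A = any? (e ≟ᵉ_) A

∈⇒Any : {e : Edge n} {A : List (Edge n)} → e ∈ A → Any (SameEdge e) A
∈⇒Any = Any.map λ { refl → refl , refl }

Free⇒∉ : {e : Edge n} {A B : List (Edge n)} → Free e A B → e ∉ A × e ∉ B
Free⇒∉ (a , b) = a ∘ ∈⇒Any , b ∘ ∈⇒Any

∉⇒Free : {e : Edge n} {A B : List (Edge n)} → e ∉ A → e ∉ B → Free e A B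
∉⇒Free a b = a ∘ Any.map SameEdge⇒≡ , b ∘ Any.map SameEdge⇒≡

edge₀ : Fin n → Edge (suc n)
edge₀ w = edge zero (suc w) (s≤s z≤n)

sucᵉ : Edge n → Edge (suc n)
sucᵉ (edge x y x<y) = edge (suc x) (suc y) (s≤s x<y)

-- The recursion splits off vertex zero, so that `length-allEdges` and `cross-count` go by induction
-- on the number of vertices.
allEdges : ∀ n → List (Edge n)
allEdges zero    = []
allEdges (suc n) = map edge₀ (allFin n) ++ map sucᵉ (allEdges n)

∈-allEdges : (e : Edge n) → e ∈ allEdges n
∈-allEdges {suc n} (edge zero zero ())
∈-allEdges {suc n} (edge zero (suc w) (s≤s z≤n)) = ∈-++⁺ˡ (∈-map⁺ edge₀ (∈-allFin w))
∈-allEdges {suc n} (edge (suc x) zero ())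
∈-allEdges {suc n} (edge (suc x) (suc y) (s≤s x<y)) =
  ∈-++⁺ʳ (map edge₀ (allFin n)) (∈-map⁺ sucᵉ (∈-allEdges (edge x y x<y)))

allEdges-unique : ∀ n → Unique (allEdges n)
allEdges-unique zero    = []
allEdges-unique (suc n) =
  ++⁺ (map⁺ (suc-injective ∘ cong v) (allFin⁺ n))
      (map⁺ sucᵉ-injective (allEdges-unique n))
      disjoint
  where
  sucᵉ-injective : ∀ {e f : Edge n} → sucᵉ e ≡ sucᵉ f → e ≡ f
  sucᵉ-injective eq = SameEdge⇒≡ (suc-injective (cong u eq) , suc-injective (cong v eq))

  disjoint : ∀ {e} → ¬ (e ∈ map edge₀ (allFin n) × e ∈ map sucᵉ (allEdges n))
  disjoint (p , q) with ∈-map⁻ edge₀ p | ∈-map⁻ sucᵉ q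
  ... | _ , _ , refl | _ , _ , ()

search : {P : Edge n → Set} → Decidable P → Dec (∃ P)
search {n} P? with any? P? (allEdges n)
... | yes p = yes (satisfied p)
... | no ¬p = no λ { (e , pe) → ¬p (Any.map (λ { refl → pe }) (∈-allEdges e)) }

-- Counting over all edges of the complete graph turns inclusion, union and disjointness of edge
-- sets into termwise inequalities of indicators, with no regard to repetitions or order in the
-- lists of claimed edges.
# : {P : Edge n → Set} → Decidable P → ℕ
# {n} P? = ∑ (ind ∘ P?) (allEdges n)

#-≟ : (e : Edge n) → # (e ≟ᵉ_) ≡ 1
#-≟ {n} e = ∑-ind-single (e ≟ᵉ_) refl (λ p → p) (allEdges-unique n) (∈-allEdges e)

#-mono : {P Q : Edge n → Set} (P? : Decidable P) (Q? : Decidable Q) →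
  (∀ e → P e → Q e) → # P? ≤ # Q?
#-mono P? Q? f = ∑-mono (λ e → ind-mono (P? e) (Q? e) (f e)) (allEdges _)

#-⊎ : {P Q R : Edge n → Set} (P? : Decidable P) (Q? : Decidable Q) (R? : Decidable R) →
  (∀ e → P e → Q e ⊎ R e) → # P? ≤ # Q? + # R?
#-⊎ P? Q? R? f = ∑-≤+ (λ e → ind-⊎ (P? e) (Q? e) (R? e) (f e)) (allEdges _)

#-disjoint : {P Q R : Edge n → Set} (P? : Decidable P) (Q? : Decidable Q) (R? : Decidable R) →
  (∀ e → P e → R e) → (∀ e → Q e → R e) → (∀ e → P e → ¬ Q e) → # P? + # Q? ≤ # R?
#-disjoint P? Q? R? f g d =
  ∑-+≤ (λ e → ind-disjoint (P? e) (Q? e) (R? e) (f e) (g e) (d e)) (allEdges _)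

#-insert-≤ : {P Q : Edge n → Set} (P? : Decidable P) (Q? : Decidable Q) (g : Edge n) →
  (∀ e → P e → g ≡ e ⊎ Q e) → # P? ≤ suc (# Q?)
#-insert-≤ P? Q? g f = ≤-trans (#-⊎ P? (g ≟ᵉ_) Q? f) (≤-reflexive (cong (_+ _) (#-≟ g)))

#-insert-≥ : {P Q : Edge n → Set} (P? : Decidable P) (Q? : Decidable Q) (g : Edge n) →
  P g → ¬ Q g → (∀ e → Q e → P e) → suc (# Q?) ≤ # P?
#-insert-≥ P? Q? g pg ¬qg f = ≤-trans (≤-reflexive (cong (_+ _) (sym (#-≟ g))))
  (#-disjoint (g ≟ᵉ_) Q? P? (λ { _ refl → pg }) f (λ { _ refl → ¬qg }))

#-∈-≤ : (A : List (Edge n)) → # (_∈? A) ≤ length A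
#-∈-≤ {n} []      = ≤-reflexive (∑-ind-none (_∈? []) (All.tabulate {xs = allEdges n} λ _ ()))
#-∈-≤     (e ∷ A) = ≤-trans
  (#-insert-≤ (_∈? (e ∷ A)) (_∈? A) e λ { _ (here refl) → inj₁ refl ; _ (there p) → inj₂ p })
  (s≤s (#-∈-≤ A))

length-allEdges : ∀ n → 2 * length (allEdges n) + n ≡ n * n
length-allEdges n = trans (cong (λ m → 2 * m + n) (sym (∑-one (allEdges n)))) (go n)
  where
  step : ∀ n a → 2 * (n + a) + suc n ≡ 2 * n + 1 + (2 * a + n)
  step = solve-∀
  square : ∀ n → 2 * n + 1 + n * n ≡ suc n * suc n
  square = solve-∀
  go : ∀ n → 2 * ∑ (λ _ → 1) (allEdges n) + n ≡ n * n
  go zero = refl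
  go (suc n)
    rewrite ∑-++ (λ _ → 1) (map edge₀ (allFin n)) (map sucᵉ (allEdges n))
          | ∑-map (λ _ → 1) edge₀ (allFin n)
          | ∑-map (λ _ → 1) sucᵉ (allEdges n)
          | ∑-one (allFin n) | length-tabulate {n = n} (λ i → i) =
    trans (step n _) (trans (cong (2 * n + 1 +_) (go n)) (square n))

-- Two-colourings and the sizes of their cuts.

Colouring : ℕ → Set
Colouring n = Fin n → Bool

Cross : Colouring n → Edge n → Set
Cross c e = c (u e) ≢ c (v e)

cross? : (c : Colouring n) → Decidable (Cross c)
cross? c e = ¬? (c (u e) ≟ᵇ c (v e))

classSizeIn : List (Fin n) → Colouring n → Bool → ℕ
classSizeIn vs c b = ∑ (λ w → ind (c w ≟ᵇ b)) vs

classSize : Colouring n → Bool → ℕ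
classSize {n} = classSizeIn (allFin n)

classSize-suc : (c : Colouring (suc n)) (b : Bool) →
  classSize c b ≡ ind (c zero ≟ᵇ b) + classSize (c ∘ suc) b
classSize-suc {n} c b = trans (cong (∑ f) (allFin-suc n))
  (cong (f zero +_) (∑-map f suc (allFin n)))
  where
  f : Fin (suc n) → ℕ
  f w = ind (c w ≟ᵇ b)

classSize-total : (c : Colouring n) → classSize c true + classSize c false ≡ n
classSize-total {zero}  c = refl
classSize-total {suc n} c
  rewrite classSize-suc c true | classSize-suc c false with c zero
... | true  = cong suc (classSize-total (c ∘ suc))
... | false = trans (+-suc _ _) (cong suc (classSize-total (c ∘ suc)))

-- By induction: the crossing edges at vertex zero lead exactly to the remaining vertices of the
-- opposite colour, which is the increase of the product when one factor grows by one.
cross-count : (c : Colouring n) → # (cross? c) ≡ classSize c true * classSize c false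
cross-count {zero}  c = refl
cross-count {suc n} c
  rewrite ∑-++ (ind ∘ cross? c) (map edge₀ (allFin n)) (map sucᵉ (allEdges n))
        | ∑-map (ind ∘ cross? c) edge₀ (allFin n)
        | ∑-map (ind ∘ cross? c) sucᵉ (allEdges n)
        | cross-count (c ∘ suc)
        | classSize-suc c true | classSize-suc c false with c zero
... | true = cong (_+ classSize (c ∘ suc) true * classSize (c ∘ suc) false)
      (∑-cong (λ w → opposite (c (suc w))) (allFin n))
      where
      opposite : ∀ b → ind (¬? (true ≟ᵇ b)) ≡ ind (b ≟ᵇ false)
      opposite true  = refl
      opposite false = refl
... | false = trans (cong (_+ classSize (c ∘ suc) true * classSize (c ∘ suc) false)
      (∑-cong (λ w → opposite (c (suc w))) (allFin n)))
      (sym (*-suc (classSize (c ∘ suc) true) (classSize (c ∘ suc) false)))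
      where
      opposite : ∀ b → ind (¬? (false ≟ᵇ b)) ≡ ind (b ≟ᵇ true)
      opposite true  = refl
      opposite false = refl

-- Lower bound

FreeCross : Colouring n → List (Edge n) → List (Edge n) → Edge n → Set
FreeCross c A B e = Cross c e × e ∉ A × e ∉ B

freeCross? : (c : Colouring n) (A B : List (Edge n)) → Decidable (FreeCross c A B)
freeCross? c A B e = cross? c e ×-dec ¬? (e ∈? A) ×-dec ¬? (e ∈? B)

freeCross-∷ˡ : ∀ (c : Colouring n) A B g →
  # (freeCross? c A B) ≤ suc (# (freeCross? c (g ∷ A) B))
freeCross-∷ˡ c A B g = #-insert-≤ (freeCross? c A B) (freeCross? c (g ∷ A) B) g split
  where
  split : ∀ e → FreeCross c A B e → g ≡ e ⊎ FreeCross c (g ∷ A) B e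
  split e (ce , e∉A , e∉B) with g ≟ᵉ e
  ... | yes g≡e = inj₁ g≡e
  ... | no g≢e  = inj₂ (ce , (λ { (here e≡g) → g≢e (sym e≡g) ; (there e∈A) → e∉A e∈A }) , e∉B)

freeCross-∷ʳ : ∀ (c : Colouring n) A B g →
  # (freeCross? c A B) ≤ suc (# (freeCross? c A (g ∷ B)))
freeCross-∷ʳ c A B g = #-insert-≤ (freeCross? c A B) (freeCross? c A (g ∷ B)) g split
  where
  split : ∀ e → FreeCross c A B e → g ≡ e ⊎ FreeCross c A (g ∷ B) e
  split e (ce , e∉A , e∉B) with g ≟ᵉ e
  ... | yes g≡e = inj₁ g≡e
  ... | no g≢e  = inj₂ (ce , e∉A , λ { (here e≡g) → g≢e (sym e≡g) ; (there e∈B) → e∉B e∈B })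

module _ (c : Colouring n) where

  mutual

    -- Avoider claims crossing edges as long as one is free, which keeps his graph bipartite. A
    -- round uses up at most two crossing edges, and he cannot lose before they run out.
    follow-cut-avoider : ∀ {k A B} → All (Cross c) A → AvTurn n k A B →
      # (freeCross? c A B) ≤ k + k
    follow-cut-avoider cA (av-lost lost) = ⊥-elim (lost (c , cA))
    follow-cut-avoider {suc k} {A} {B} cA (av-move _ reply) with search (freeCross? c A B)
    ... | no none = ≤-trans (≤-reflexive (∑-ind-none (freeCross? c A B)
            (All.tabulate {xs = allEdges n} λ {e} _ fe → none (e , fe)))) z≤n
    ... | yes (e , ce , e∉A , e∉B) = begin
      # (freeCross? c A B)             ≤⟨ freeCross-∷ˡ c A B e ⟩
      suc (# (freeCross? c (e ∷ A) B)) ≤⟨ s≤s (follow-cut-enforcer (ce ∷ cA) (reply e (∉⇒Free e∉A e∉B))) ⟩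
      suc (suc (k + k))                ≡⟨ cong suc (+-suc k k) ⟨
      suc k + suc k                    ∎
      where open ≤-Reasoning

    follow-cut-enforcer : ∀ {k A B} → All (Cross c) A → EnTurn n k A B →
      # (freeCross? c A B) ≤ suc (k + k)
    follow-cut-enforcer cA (en-lost lost) = ⊥-elim (lost (c , cA))
    follow-cut-enforcer {A = A} {B} cA (en-move e _ next) =
      ≤-trans (freeCross-∷ʳ c A B e) (s≤s (follow-cut-avoider cA next))

  -- Only the crossing edges of `B` are charged, so every edge that Enforcer wasted inside a colour
  -- class leaves one more free crossing edge to Avoider.
  cross-≤ : ∀ A B → # (cross? c) ≤ # (freeCross? c A B) + (length A + ∑ (ind ∘ cross? c) B)
  cross-≤ A [] = ≤-trans
    (#-⊎ (cross? c) (freeCross? c A []) (_∈? A) split)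
    (+-monoʳ-≤ _ (≤-trans (#-∈-≤ A) (m≤m+n _ _)))
    where
    split : ∀ e → Cross c e → FreeCross c A [] e ⊎ e ∈ A
    split e ce with e ∈? A
    ... | yes e∈A = inj₂ e∈A
    ... | no e∉A  = inj₁ (ce , e∉A , λ ())
  cross-≤ A (g ∷ B) with cross? c g
  ... | yes _ = begin
    # (cross? c)                                              ≤⟨ cross-≤ A B ⟩
    # (freeCross? c A B) + rest                               ≤⟨ +-monoˡ-≤ rest (freeCross-∷ʳ c A B g) ⟩
    suc (# (freeCross? c A (g ∷ B))) + rest                   ≡⟨ move (# (freeCross? c A (g ∷ B))) (length A) _ ⟩
    # (freeCross? c A (g ∷ B)) + (length A + suc (∑ (ind ∘ cross? c) B)) ∎
    where
    open ≤-Reasoning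
    rest : ℕ
    rest = length A + ∑ (ind ∘ cross? c) B
    move : ∀ f a b → suc f + (a + b) ≡ f + (a + suc b)
    move = solve-∀
  ... | no mono = ≤-trans (cross-≤ A B) (+-monoˡ-≤ _
    (#-mono (freeCross? c A B) (freeCross? c A (g ∷ B))
      λ { e (ce , e∉A , e∉B) → ce , e∉A , λ { (here refl) → mono ce ; (there e∈B) → e∉B e∈B } }))

-- Choosing a cut at random and derandomising the choice.

mono? : (c : Colouring n) (e : Edge n) → Dec (c (u e) ≡ c (v e))
mono? c e = c (u e) ≟ᵇ c (v e)

mono+cross : (c : Colouring n) (B : List (Edge n)) →
  ∑ (ind ∘ mono? c) B + ∑ (ind ∘ cross? c) B ≡ length B
mono+cross c B = trans (sym (∑-+ B)) (trans (∑-cong one B) (∑-one B))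
  where
  one : ∀ e → ind (mono? c e) + ind (cross? c e) ≡ 1
  one e with c (u e) ≟ᵇ c (v e)
  ... | yes _ = refl
  ... | no _  = refl

_⊕_ : Colouring n → Colouring n → Colouring n
(t ⊕ c) w = t w xor c w

-- Twice the probability that e is monochromatic when each toggle in the list is applied to c
-- independently with probability 1/2.
gain : List (Colouring n) → Colouring n → Edge n → ℕ
gain []       c e = 2 * ind (mono? c e)
gain (t ∷ ts) c e with cross? t e
... | yes _ = 1
... | no _  = gain ts c e

-- A toggle separating the ends of `e` makes `e` monochromatic with probability exactly 1/2,
-- whatever the other toggles do.
gain-split : ∀ (ts : List (Colouring n)) c e → Any (λ t → Cross t e) ts → 1 ≤ gain ts c e
gain-split (t ∷ ts) c e split with cross? t e | split
... | yes _  | _         = ≤-refl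
... | no ¬te | here te   = ⊥-elim (¬te te)
... | no _   | there any = gain-split ts c e any

mono-⊕-cross : ∀ (t c : Colouring n) e → Cross t e →
  ind (mono? c e) + ind (mono? (t ⊕ c) e) ≡ 1
mono-⊕-cross t c e te with t (u e) | t (v e) | c (u e) | c (v e)
... | true  | true  | _     | _     = ⊥-elim (te refl)
... | false | false | _     | _     = ⊥-elim (te refl)
... | true  | false | true  | true  = refl
... | true  | false | true  | false = refl
... | true  | false | false | true  = refl
... | true  | false | false | false = refl
... | false | true  | true  | true  = refl
... | false | true  | true  | false = refl
... | false | true  | false | true  = refl
... | false | true  | false | false = refl

mono-⊕-same : ∀ (t c : Colouring n) e → ¬ Cross t e → ind (mono? c e) ≡ ind (mono? (t ⊕ c) e)
mono-⊕-same t c e te with t (u e) | t (v e) | c (u e) | c (v e)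
... | true  | false | _     | _     = ⊥-elim (te λ ())
... | false | true  | _     | _     = ⊥-elim (te λ ())
... | false | false | _     | _     = refl
... | true  | true  | true  | true  = refl
... | true  | true  | true  | false = refl
... | true  | true  | false | true  = refl
... | true  | true  | false | false = refl

-- If a later toggle separates `e`, both values are 1. Otherwise `e` is monochromatic in exactly one
-- of `c` and `t ⊕ c`.
gain-cross : ∀ (t : Colouring n) ts c e → Cross t e → 2 ≤ gain ts c e + gain ts (t ⊕ c) e
gain-cross t []        c e te = ≤-reflexive (trans (cong (2 *_) (sym (mono-⊕-cross t c e te)))
  (*-distribˡ-+ 2 (ind (mono? c e)) (ind (mono? (t ⊕ c) e))))
gain-cross t (t′ ∷ ts) c e te with cross? t′ e
... | yes _ = ≤-refl
... | no _  = gain-cross t ts c e te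

gain-same : ∀ (t : Colouring n) ts c e → ¬ Cross t e → gain ts c e ≡ gain ts (t ⊕ c) e
gain-same t []        c e te = cong (2 *_) (mono-⊕-same t c e te)
gain-same t (t′ ∷ ts) c e te with cross? t′ e
... | yes _ = refl
... | no _  = gain-same t ts c e te

-- One step of conditional expectation: the value before `t` is decided does not exceed the average
-- over its two outcomes.
gain-average : ∀ (t : Colouring n) ts c e →
  gain (t ∷ ts) c e + gain (t ∷ ts) c e ≤ gain ts c e + gain ts (t ⊕ c) e
gain-average t ts c e with cross? t e
... | yes te = gain-cross t ts c e te
... | no ¬te = +-monoʳ-≤ (gain ts c e) (≤-reflexive (gain-same t ts c e ¬te))

half-≤ : ∀ {a b c} → a + a ≤ b + c → a ≤ b ⊎ a ≤ c
half-≤ {a} {b} {c} le with ≤-total a b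
... | inj₁ a≤b = inj₁ a≤b
... | inj₂ b≤a = inj₂ (+-cancelˡ-≤ a a c (≤-trans le (+-monoˡ-≤ c b≤a)))

-- Method of conditional expectations: the toggles are decided one after another, each time for the
-- outcome that does not lower the expected number of monochromatic edges of `B`. The predicate `S`
-- carries an invariant of the colouring through these decisions.
orient : ∀ (ts : List (Colouring n)) (B : List (Edge n)) (S : Colouring n → Set) →
  All (λ t → ∀ c → S c → S (t ⊕ c)) ts → ∀ c → S c →
  ∃ λ c′ → S c′ × ∑ (gain ts c) B ≤ 2 * ∑ (ind ∘ mono? c′) B
orient []       B S _ c sc = c , sc , ≤-reflexive (double B)
  where
  double : ∀ B → ∑ (λ e → 2 * ind (mono? c e)) B ≡ 2 * ∑ (ind ∘ mono? c) B
  double []      = refl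
  double (e ∷ B) = trans (cong (2 * ind (mono? c e) +_) (double B))
    (sym (*-distribˡ-+ 2 (ind (mono? c e)) (∑ (ind ∘ mono? c) B)))
orient (t ∷ ts) B S (closed ∷ closeds) c sc
  with half-≤ (≤-trans (∑-+≤ {f = gain (t ∷ ts) c} (gain-average t ts c) B) (≤-reflexive (∑-+ B)))
... | inj₁ le with c′ , sc′ , le′ ← orient ts B S closeds c sc = c′ , sc′ , ≤-trans le le′
... | inj₂ le with c′ , sc′ , le′ ← orient ts B S closeds (t ⊕ c) (closed c sc) = c′ , sc′ , ≤-trans le le′

-- Balanced cuts that separate consecutive pairs of a vertex list.

-- The list is read as consecutive disjoint pairs, with a leftover last entry if its length is odd.
-- In `ends A ++ R` the first pairs are the edges of the matching `A`; the remaining pairs are made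
-- up from unmatched vertices to balance the cut.
data Paired (_~_ : X → X → Set) : List X → Set where
  []   : Paired _~_ []
  [-]  : ∀ {x} → Paired _~_ (x ∷ [])
  _∷_  : ∀ {x y xs} → x ~ y → Paired _~_ xs → Paired _~_ (x ∷ y ∷ xs)

Alternating : Colouring n → List (Fin n) → Set
Alternating c = Paired (λ x y → c x ≢ c y)

Constant : Colouring n → List (Fin n) → Set
Constant t = Paired (λ x y → t x ≡ t y)

-- The toggle flips both entries of a pair or neither, so a separated pair stays separated.
⊕-alternating : ∀ {t c : Colouring n} {vs} → Constant t vs → Alternating c vs → Alternating (t ⊕ c) vs
⊕-alternating []       []       = []
⊕-alternating [-]      [-]      = [-]
⊕-alternating {t = t} {c} (_∷_ {x} {y} tx≡ty ts) (cx≢cy ∷ cs) = differ ∷ ⊕-alternating ts cs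
  where
  differ : (t x xor c x) ≢ (t y xor c y)
  differ eq rewrite tx≡ty with t y
  ... | true  = cx≢cy (not-injective eq)
  ... | false = cx≢cy eq

false-constant : ∀ {t : Colouring n} {vs} → (∀ {w} → w ∈ vs → t w ≡ false) → Constant t vs
false-constant {vs = []}         _ = []
false-constant {vs = _ ∷ []}     _ = [-]
false-constant {vs = _ ∷ _ ∷ vs} f =
  trans (f (here refl)) (sym (f (there (here refl)))) ∷ false-constant (f ∘ there ∘ there)

alternating-cong : ∀ {c d : Colouring n} {vs} → (∀ {w} → w ∈ vs → d w ≡ c w) →
  Alternating c vs → Alternating d vs
alternating-cong d≡c []        = []
alternating-cong d≡c [-]       = [-]
alternating-cong d≡c (ne ∷ cs) =
  (λ eq → ne (trans (sym (d≡c (here refl))) (trans eq (d≡c (there (here refl))))))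
    ∷ alternating-cong (d≡c ∘ there ∘ there) cs

alternate : {vs : List (Fin n)} → Unique vs → ∃ λ c → Alternating c vs
alternate {vs = []}         _ = (λ _ → true) , []
alternate {vs = _ ∷ []}     _ = (λ _ → true) , [-]
alternate {n} {x ∷ y ∷ vs} ((x≢y ∷ x∉) ∷ y∉ ∷ uniq) with c , alt ← alternate uniq =
  d , (λ eq → true≢false (trans (sym dx) (trans eq dy))) ∷ alternating-cong rest alt
  where
  d : Colouring n
  d w = if does (w ≟ x) then true else if does (w ≟ y) then false else c w
  true≢false : true ≢ false
  true≢false ()
  dx : d x ≡ true
  dx rewrite dec-true (x ≟ x) refl = refl
  dy : d y ≡ false
  dy rewrite dec-false (y ≟ x) (x≢y ∘ sym) | dec-true (y ≟ y) refl = refl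
  rest : ∀ {w} → w ∈ vs → d w ≡ c w
  rest {w} w∈ rewrite dec-false (w ≟ x) (λ eq → All.lookup x∉ w∈ (sym eq))
                    | dec-false (w ≟ y) (λ eq → All.lookup y∉ w∈ (sym eq)) = refl

-- The inequality is (p - q)^2 at most 1 without subtraction, and p - q is unchanged when both
-- classes gain a vertex.
balanced-step : ∀ p q → (p + q) * (p + q) ≤ 4 * (p * q) + 1 →
  (suc p + suc q) * (suc p + suc q) ≤ 4 * (suc p * suc q) + 1
balanced-step p q le = subst₂ _≤_ (sym (left p q)) (sym (right p q)) (+-monoˡ-≤ (4 * (p + q) + 4) le)
  where
  left : ∀ p q → (suc p + suc q) * (suc p + suc q) ≡ (p + q) * (p + q) + (4 * (p + q) + 4)
  left = solve-∀
  right : ∀ p q → 4 * (suc p * suc q) + 1 ≡ 4 * (p * q) + 1 + (4 * (p + q) + 4)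
  right = solve-∀

-- Each separated pair adds one vertex to either class; only a leftover vertex makes the classes
-- differ, by one.
alternating-balanced : (c : Colouring n) {vs : List (Fin n)} → Alternating c vs →
  let p = classSizeIn vs c true
      q = classSizeIn vs c false
  in (p + q) * (p + q) ≤ 4 * (p * q) + 1
alternating-balanced c [] = z≤n
alternating-balanced c ([-] {x}) with c x
... | true  = ≤-refl
... | false = ≤-refl
alternating-balanced c (_∷_ {x} {y} {vs} ne alt) with c x | c y
... | true  | true  = ⊥-elim (ne refl)
... | false | false = ⊥-elim (ne refl)
... | true  | false = balanced-step (classSizeIn vs c true) (classSizeIn vs c false) (alternating-balanced c alt)
... | false | true  = balanced-step (classSizeIn vs c true) (classSizeIn vs c false) (alternating-balanced c alt)

Unique-resp-↭ : {xs ys : List X} → xs ↭ ys → Unique xs → Unique ys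
Unique-resp-↭ p = Permutationₛ.Unique-resp-↭ (setoid _) (↭⇒↭ₛ p)

∑-↭ : (f : X → ℕ) {xs ys : List X} → xs ↭ ys → ∑ f xs ≡ ∑ f ys
∑-↭ f p = sum-↭ (↭-map⁺ f p)

alternating-cross-count : (c : Colouring n) {vs : List (Fin n)} → Alternating c vs → vs ↭ allFin n →
  n * n ≤ 4 * # (cross? c) + 1
alternating-cross-count c alt perm =
  subst₂ (λ m x → m * m ≤ 4 * x + 1) (classSize-total c) (sym (cross-count c))
    (subst₂ (λ p q → (p + q) * (p + q) ≤ 4 * (p * q) + 1)
      (∑-↭ (λ w → ind (c w ≟ᵇ true)) perm) (∑-↭ (λ w → ind (c w ≟ᵇ false)) perm)
      (alternating-balanced c alt))

-- Matchings and the good cuts they provide.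

ends : List (Edge n) → List (Fin n)
ends []      = []
ends (e ∷ A) = u e ∷ v e ∷ ends A

∈-ends : ∀ {e : Edge n} {A} → e ∈ A → u e ∈ ends A × v e ∈ ends A
∈-ends (here refl)  = here refl , there (here refl)
∈-ends (there e∈A) with p , q ← ∈-ends e∈A = there (there p) , there (there q)

alternating⇒cross : ∀ {c : Colouring n} A {R} → Alternating c (ends A ++ R) → All (Cross c) A
alternating⇒cross []      _          = []
alternating⇒cross (e ∷ A) (ce ∷ alt) = ce ∷ alternating⇒cross A alt

-- The toggle that swaps the two ends of the matching edge `e` between the sides of a cut.
touch : Edge n → Colouring n
touch e w = does (w ≟ u e) ∨ does (w ≟ v e)

touch-u : (e : Edge n) → touch e (u e) ≡ true
touch-u e rewrite dec-true (u e ≟ u e) refl = refl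

touch-v : (e : Edge n) → touch e (v e) ≡ true
touch-v e rewrite dec-true (v e ≟ v e) refl = ∨-zeroʳ _

touch-false : (e : Edge n) {w : Fin n} → w ≢ u e → w ≢ v e → touch e w ≡ false
touch-false e {w} p q rewrite dec-false (w ≟ u e) p | dec-false (w ≟ v e) q = refl

touch-true : (e : Edge n) {w : Fin n} → touch e w ≡ true → w ≡ u e ⊎ w ≡ v e
touch-true e {w} t with w ≟ u e | w ≟ v e
... | yes p | _     = inj₁ p
... | no _  | yes q = inj₂ q
touch-true e () | no _ | no _

touch-both : (e f : Edge n) → touch e (u f) ≡ true → touch e (v f) ≡ true → f ≡ e
touch-both e f p q with touch-true e p | touch-true e q
... | inj₁ a | inj₂ b = SameEdge⇒≡ (a , b)
... | inj₁ a | inj₁ b = ⊥-elim (<⇒≢ (u<v f) (trans a (sym b)))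
... | inj₂ a | inj₂ b = ⊥-elim (<⇒≢ (u<v f) (trans a (sym b)))
... | inj₂ a | inj₁ b = ⊥-elim (<-asym (u<v f) (subst₂ _<ᶠ_ (sym b) (sym a) (u<v e)))

-- The vertex list has no repetitions, so `touch e` is true on both entries of the pair coming from
-- `e` and false on all other entries.
touch-constant : ∀ A {R} {e : Edge n} → Unique (ends A ++ R) → e ∈ A → Constant (touch e) (ends A ++ R)
touch-constant (e ∷ A) {R} ((_ ∷ u∉) ∷ v∉ ∷ _) (here refl) = trans (touch-u e) (sym (touch-v e)) ∷
  false-constant (λ w∈ → touch-false e (All.lookup u∉ w∈ ∘ sym) (All.lookup v∉ w∈ ∘ sym))
touch-constant (a ∷ A) {R} {e} ((_ ∷ u∉) ∷ v∉ ∷ uniq) (there e∈A) =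
  trans (untouched u∉) (sym (untouched v∉)) ∷ touch-constant A uniq e∈A
  where
  untouched : ∀ {x} → All (x ≢_) (ends A ++ R) → touch e x ≡ false
  untouched x∉ = touch-false e (All.lookup x∉ (∈-++⁺ˡ (proj₁ (∈-ends e∈A))))
                               (All.lookup x∉ (∈-++⁺ˡ (proj₂ (∈-ends e∈A))))

touched : ∀ (A : List (Edge n)) {w} → w ∈ ends A → Any (λ e → touch e w ≡ true) A
touched (e ∷ A) (here refl)         = here (touch-u e)
touched (e ∷ A) (there (here refl)) = here (touch-v e)
touched (e ∷ A) (there (there w∈))  = there (touched A w∈)

Inside : List (Fin n) → Edge n → Set
Inside R e = u e ∈ R × v e ∈ R

-- R lists the unmatched vertices.
record Matching {n} (A B : List (Edge n)) (R : List (Fin n)) : Set where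
  field
    covers  : ends A ++ R ↭ allFin n
    foreign : All (_∉ A) B
    meets   : All (λ f → ¬ Inside R f) B

  unique : Unique (ends A ++ R)
  unique = Unique-resp-↭ (↭-sym covers) (allFin⁺ n)

  -- An Enforcer edge has an end on some matching edge `e`. It differs from `e`, so its other end
  -- lies off `e`, and `touch e` separates the two.
  toggled : All (λ f → Any (λ t → Cross t f) (map touch A)) B
  toggled = All.tabulate λ {f} f∈B → split (All.lookup foreign f∈B) (All.lookup meets f∈B)
    where
    crossing : ∀ {f} {w} → f ∉ A → (∀ {e} → touch e w ≡ true → touch e (u f) ≡ touch e (v f) →
      f ≡ e) → w ∈ ends A → Any (λ t → Cross t f) (map touch A)
    crossing {f} f∉A both w∈ with e , e∈A , te ← find (touched A w∈) =
      lose (∈-map⁺ touch e∈A) λ eq → f∉A (subst (_∈ A) (sym (both te eq)) e∈A)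

    split : ∀ {f} → f ∉ A → ¬ Inside R f → Any (λ t → Cross t f) (map touch A)
    split {f} f∉A ¬inside
      with ∈-++⁻ (ends A) (∈-resp-↭ (↭-sym covers) (∈-allFin (u f)))
         | ∈-++⁻ (ends A) (∈-resp-↭ (↭-sym covers) (∈-allFin (v f)))
    ... | inj₁ u∈ | _       = crossing f∉A (λ te eq → touch-both _ f te (trans (sym eq) te)) u∈
    ... | inj₂ _  | inj₁ v∈ = crossing f∉A (λ te eq → touch-both _ f (trans eq te) te) v∈
    ... | inj₂ u∈ | inj₂ v∈ = ⊥-elim (¬inside (u∈ , v∈))

  bipartite : Bipartite A
  bipartite with c , alt ← alternate unique = c , alternating⇒cross A alt

  -- Every Enforcer edge is separated by the toggle of some matching edge, so in expectation half of
  -- `B` is monochromatic, and `orient` finds an alternating colouring that does at least as well.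
  good-cut : ∃ λ c → Alternating c (ends A ++ R) × length B ≤ 2 * ∑ (ind ∘ mono? c) B
  good-cut =
    let c , alt , le = orient (map touch A) B (λ c → Alternating c (ends A ++ R))
          (All.tabulate closed) (proj₁ base) (proj₂ base)
    in c , alt , ≤-trans (count toggled) le
    where
    base : ∃ λ c → Alternating c (ends A ++ R)
    base = alternate unique

    closed : ∀ {t} → t ∈ map touch A → ∀ c → Alternating c (ends A ++ R) → Alternating (t ⊕ c) (ends A ++ R)
    closed t∈ c alt with e , e∈A , refl ← ∈-map⁻ touch t∈ = ⊕-alternating (touch-constant A unique e∈A) alt

    count : ∀ {B} → All (λ f → Any (λ t → Cross t f) (map touch A)) B →
      length B ≤ ∑ (gain (map touch A) (proj₁ base)) B
    count []                = z≤n
    count {f ∷ _} (tf ∷ tB) = +-mono-≤ (gain-split (map touch A) (proj₁ base) f tf) (count tB)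

open Matching

-- The good cut has at least (n^2 - 1)/4 edges. It is filled by `A`, by at most half of `B`, and by
-- free edges, of which `follow-cut-enforcer` allows at most 2k + 1. Hence an Enforcer edge is
-- charged 2 where an Avoider edge is charged 4.
matching-done : ∀ {k} {A B : List (Edge n)} {R} → Matching A B R → EnTurn n k A B →
  n * n ≤ 8 * k + 5 + (4 * length A + 2 * length B)
matching-done {n} {k} {A} {B} M turn with c , alt , mono-≥ ← good-cut M = begin
  n * n                                      ≤⟨ alternating-cross-count c alt (covers M) ⟩
  4 * # (cross? c) + 1                       ≤⟨ +-monoˡ-≤ 1 (*-monoʳ-≤ 4 (cross-≤ c A B)) ⟩
  4 * (# (freeCross? c A B) + (length A + χ)) + 1
    ≤⟨ +-monoˡ-≤ 1 (*-monoʳ-≤ 4 (+-monoˡ-≤ _ (follow-cut-enforcer c (alternating⇒cross A alt) turn))) ⟩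
  4 * (suc (k + k) + (length A + χ)) + 1     ≡⟨ expand k (length A) χ ⟩
  8 * k + 5 + (4 * length A + 2 * (2 * χ))   ≤⟨ +-monoʳ-≤ (8 * k + 5) (+-monoʳ-≤ (4 * length A) (*-monoʳ-≤ 2 2χ≤)) ⟩
  8 * k + 5 + (4 * length A + 2 * length B)  ∎
  where
  open ≤-Reasoning
  χ μ : ℕ
  χ = ∑ (ind ∘ cross? c) B
  μ = ∑ (ind ∘ mono? c) B
  expand : ∀ k a x → 4 * (1 + (k + k) + (a + x)) + 1 ≡ 8 * k + 5 + (4 * a + 2 * (2 * x))
  expand = solve-∀
  distrib : ∀ x m → 2 * x + 2 * m ≡ (m + x) + (m + x)
  distrib = solve-∀
  2χ≤ : 2 * χ ≤ length B
  2χ≤ = +-cancelʳ-≤ (length B) (2 * χ) (length B) (begin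
    2 * χ + length B        ≤⟨ +-monoʳ-≤ (2 * χ) mono-≥ ⟩
    2 * χ + 2 * μ           ≡⟨ distrib χ μ ⟩
    (μ + χ) + (μ + χ)       ≡⟨ cong₂ _+_ (mono+cross c B) (mono+cross c B) ⟩
    length B + length B     ∎)

-- Avoider's matching phase.

pull : ∀ {x : X} {xs} → x ∈ xs → ∃ λ ys → xs ↭ x ∷ ys
pull {x = x} x∈ with h , t , refl ← ∈-∃++ x∈ = h ++ t , shift x h t

edge-between : {x y : Fin n} → x ≢ y → ∃ λ g → ∀ R → x ∷ y ∷ R ↭ u g ∷ v g ∷ R
edge-between {x = x} {y} x≢y with <-cmp x y
... | tri< x<y _ _ = edge x y x<y , λ _ → ↭-refl
... | tri≈ _ x≡y _ = ⊥-elim (x≢y x≡y)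
... | tri> _ _ y<x = edge y x y<x , λ _ → ↭-swap x y ↭-refl

-- The new matching edge meets e.
choose : ∀ {R : List (Fin n)} → Unique R → 3 ≤ length R → ∀ e →
  ∃ λ g → ∃ λ R′ → R ↭ u g ∷ v g ∷ R′ × g ≢ e × ¬ Inside R′ e
choose {R = R} uniq 3≤ e with any? (u e ≟_) R | any? (v e ≟_) R
choose {R = R} uniq 3≤ e | yes u∈ | yes v∈
  with R₁ , p ← pull u∈ with ∈-resp-↭ p v∈
... | here eq = ⊥-elim (<⇒≢ (u<v e) (sym eq))
... | there v∈₁ with pull v∈₁
... | [] , q = ⊥-elim (<⇒≱ (s≤s (s≤s (s≤s z≤n))) (subst (3 ≤_) (↭-length (↭-trans p (↭-prep (u e) q))) 3≤))
-- With both ends of `e` unmatched, `u e` is matched to a third unmatched vertex `z`. Then `e` is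
-- met, and the new edge is not `e` because `v e` stays unmatched.
... | z ∷ R₂ , q with r ← ↭-trans p (↭-prep (u e) (↭-trans q (↭-swap (v e) z ↭-refl)))
  with Unique-resp-↭ r uniq
... | (u≢z ∷ u∉) ∷ _ with g , s ← edge-between u≢z =
  g , v e ∷ R₂ , ↭-trans r (s (v e ∷ R₂)) , g≢e , λ (u∈′ , _) → All.lookup u∉ u∈′ refl
  where
  g≢e : g ≢ e
  g≢e refl with Unique-resp-↭ (↭-trans r (s (v e ∷ R₂))) uniq
  ... | _ ∷ (v≢v ∷ _) ∷ _ = v≢v refl
-- An end of `e` is already outside `R`, so any two unmatched vertices will do.
choose {R = x ∷ y ∷ R′} ((x≢y ∷ _) ∷ _) _ e | no u∉ | _ with g , s ← edge-between x≢y =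
  g , R′ , s R′ , (λ { refl → u∉ (∈-resp-↭ (↭-sym (s R′)) (here refl)) }) , u∉ ∘ there ∘ there ∘ proj₁
choose {R = x ∷ y ∷ R′} ((x≢y ∷ _) ∷ _) _ e | yes _ | no v∉ with g , s ← edge-between x≢y =
  g , R′ , s R′ , (λ { refl → v∉ (∈-resp-↭ (↭-sym (s R′)) (there (here refl))) }) , v∉ ∘ there ∘ there ∘ proj₂
choose {R = x ∷ []} uniq (s≤s ()) e | no _ | _
choose {R = x ∷ []} uniq (s≤s ()) e | yes _ | no _

unique-++⁻ʳ : ∀ (xs : List X) {ys} → Unique (xs ++ ys) → Unique ys
unique-++⁻ʳ []       uniq       = uniq
unique-++⁻ʳ (x ∷ xs) (_ ∷ uniq) = unique-++⁻ʳ xs uniq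

unique-disjoint : ∀ (xs : List X) {ys w} → Unique (xs ++ ys) → w ∈ xs → w ∉ ys
unique-disjoint (x ∷ xs) (x∉ ∷ _)   (here refl) w∈ys = All.lookup x∉ (∈-++⁺ʳ xs w∈ys) refl
unique-disjoint (x ∷ xs) (_ ∷ uniq) (there w∈)  w∈ys = unique-disjoint xs uniq w∈ w∈ys

mutual

  -- The edge e stands for Enforcer's last move, the only one that may miss the matching.
  matching-avoider : ∀ j {k} {A B : List (Edge n)} {R} (e : Edge n) →
    ends A ++ R ↭ allFin n → All (_∉ A) B → All (λ f → f ≡ e ⊎ ¬ Inside R f) B →
    j + j + 4 ≤ length R → AvTurn n k A B →
    n * n + (j + j) ≤ 8 * k + 1 + (4 * length A + 2 * length B)
  matching-avoider {n} j {k} {A} {B} {R} e covers foreign meets len turn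
    with uniq ← Unique-resp-↭ (↭-sym covers) (allFin⁺ n)
    with g , R′ , p , g≢e , ¬inside ← choose (unique-++⁻ʳ (ends A) uniq)
      (≤-trans (n≤1+n 3) (≤-trans (m≤n+m 4 (j + j)) len)) e
    = play turn
    where
    u∈ : u g ∈ R
    u∈ = ∈-resp-↭ (↭-sym p) (here refl)

    v∈ : v g ∈ R
    v∈ = ∈-resp-↭ (↭-sym p) (there (here refl))

    g∉A : g ∉ A
    g∉A g∈A = unique-disjoint (ends A) uniq (proj₁ (∈-ends g∈A)) u∈

    g∉B : g ∉ B
    g∉B g∈B with All.lookup meets g∈B
    ... | inj₁ g≡e     = g≢e g≡e
    ... | inj₂ outside = outside (u∈ , v∈)

    covers′ : ends (g ∷ A) ++ R′ ↭ allFin n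
    covers′ = ↭-trans
      (↭-trans (↭-prep (u g) (↭-sym (shift (v g) (ends A) R′))) (↭-sym (shift (u g) (ends A) (v g ∷ R′))))
      (↭-trans (++⁺ˡ (ends A) (↭-sym p)) covers)

    M : Matching (g ∷ A) B R′
    M = record
      { covers = covers′
      ; foreign = All.tabulate λ { f∈B (here refl) → g∉B f∈B
                                 ; f∈B (there f∈A) → All.lookup foreign f∈B f∈A }
      ; meets = All.map meets′ meets }
      where
      widen : ∀ {w} → w ∈ R′ → w ∈ R
      widen w∈ = ∈-resp-↭ (↭-sym p) (there (there w∈))

      meets′ : ∀ {f} → f ≡ e ⊎ ¬ Inside R f → ¬ Inside R′ f
      meets′ (inj₁ refl)    inside  = ¬inside inside
      meets′ (inj₂ outside) (a , b) = outside (widen a , widen b)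

    len′ : j + j + 2 ≤ length R′
    len′ = +-cancelˡ-≤ 2 (j + j + 2) (length R′) (≤-trans
      (≤-reflexive (trans (+-comm 2 (j + j + 2)) (+-assoc (j + j) 2 2)))
      (subst (j + j + 4 ≤_) (↭-length p) len))

    play : AvTurn n k A B → n * n + (j + j) ≤ 8 * k + 1 + (4 * length A + 2 * length B)
    play (av-lost lost) with c , alt ← alternate uniq = ⊥-elim (lost (c , alternating⇒cross A alt))
    play (av-move {k = k′} _ reply) = ≤-trans
      (matching-enforcer j M len′ (reply g (∉⇒Free g∉A g∉B)))
      (≤-reflexive (regroup k′ (length A) (length B)))
      where
      regroup : ∀ k a b → 8 * k + 5 + (4 * suc a + 2 * b) ≡ 8 * suc k + 1 + (4 * a + 2 * b)
      regroup = solve-∀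

  -- Here `j` counts the Enforcer moves still to be answered by a matching edge, each of which uses
  -- up two unmatched vertices. Every such Enforcer edge is charged 2 instead of 4, and the saved 2
  -- accumulates in `j + j`. At `j` equal to zero Avoider settles on a cut.
  matching-enforcer : ∀ j {k} {A B : List (Edge n)} {R} → Matching A B R →
    j + j + 2 ≤ length R → EnTurn n k A B →
    n * n + (j + j) ≤ 8 * k + 5 + (4 * length A + 2 * length B)
  matching-enforcer j M _ (en-lost lost) = ⊥-elim (lost (bipartite M))
  matching-enforcer {n} zero M _ turn = ≤-trans (≤-reflexive (+-identityʳ (n * n))) (matching-done M turn)
  matching-enforcer {n} (suc j) {k} {A} {B} {R} M len (en-move e free next) =
    ≤-trans (≤-reflexive (left n j)) (≤-trans (+-monoʳ-≤ 2
      (matching-avoider j e (covers M) (proj₁ (Free⇒∉ free) ∷ foreign M)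
        (inj₁ refl ∷ All.map inj₂ (meets M)) (≤-trans (≤-reflexive (length-shift j)) len) next))
      (≤-reflexive (right k (length A) (length B))))
    where
    left : ∀ n j → n * n + (suc j + suc j) ≡ 2 + (n * n + (j + j))
    left = solve-∀
    length-shift : ∀ j → j + j + 4 ≡ suc j + suc j + 2
    length-shift = solve-∀
    right : ∀ k a b → 2 + (8 * k + 1 + (4 * a + 2 * suc b)) ≡ 8 * k + 5 + (4 * a + 2 * b)
    right = solve-∀

lower-bound : ∀ j {n t} → j + j + 4 ≤ n → EnforcerWinsWithin n t → n * n + (j + j) ≤ 8 * t + 1
lower-bound j {zero}        le _ = ⊥-elim (<⇒≱ (s≤s z≤n) (≤-trans (m≤n+m 4 (j + j)) le))
lower-bound j {suc zero}    le _ = ⊥-elim (<⇒≱ (s≤s (s≤s z≤n)) (≤-trans (m≤n+m 4 (j + j)) le))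
lower-bound j {suc (suc m)} {t} le wins = ≤-trans
  -- Enforcer has not moved yet, so an arbitrary edge stands in for his last move; it exists because
  -- there are at least two vertices.
  (matching-avoider j {A = []} {[]} {allFin _} (edge zero (suc zero) (s≤s z≤n)) ↭-refl [] []
    (≤-trans le (≤-reflexive (sym (length-tabulate (λ i → i))))) wins)
  (≤-reflexive (+-identityʳ (8 * t + 1)))

-- Upper bound

cross-count-≤ : (c : Colouring n) → 4 * # (cross? c) ≤ n * n
cross-count-≤ c rewrite cross-count c =
  subst (λ m → 4 * (classSize c true * classSize c false) ≤ m * m) (classSize-total c)
    (am-gm (classSize c true) (classSize c false))
  where
  expand : ∀ p d → (p + (p + d)) * (p + (p + d)) ≡ 4 * (p * (p + d)) + d * d
  expand = solve-∀
  ordered : ∀ {p q} → p ≤ q → 4 * (p * q) ≤ (p + q) * (p + q)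
  ordered {p} p≤q with d , refl ← m≤n⇒∃[o]m+o≡n p≤q =
    ≤-trans (m≤m+n _ (d * d)) (≤-reflexive (sym (expand p d)))
  am-gm : ∀ p q → 4 * (p * q) ≤ (p + q) * (p + q)
  am-gm p q with ≤-total p q
  ... | inj₁ p≤q = ordered p≤q
  ... | inj₂ q≤p = subst₂ _≤_ (cong (4 *_) (*-comm q p)) (cong₂ _*_ (+-comm q p) (+-comm q p)) (ordered q≤p)

#-∷ : {e : Edge n} {A : List (Edge n)} → e ∉ A → # (_∈? (e ∷ A)) ≡ suc (# (_∈? A))
#-∷ {e = e} {A} e∉A = ≤-antisym
  (#-insert-≤ (_∈? (e ∷ A)) (_∈? A) e λ { _ (here refl) → inj₁ refl ; _ (there p) → inj₂ p })
  (#-insert-≥ (_∈? (e ∷ A)) (_∈? A) e (here refl) e∉A λ _ → there)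

-- The connected components of Avoider's graph, each with its 2-colouring; rigid says that a
-- proper colouring agrees with colour up to a swap on each component.
record Components {n} (A : List (Edge n)) : Set where
  field
    root      : Fin n → Fin n
    colour    : Colouring n
    root-idem : ∀ w → root (root w) ≡ root w
    joined    : All (λ e → root (u e) ≡ root (v e)) A
    proper    : All (Cross colour) A
    rigid     : ∀ c → All (Cross c) A → ∀ w → c w xor colour w ≡ c (root w) xor colour (root w)

  -- Every proper colouring of A separates the ends of a locked edge.
  Locked : Edge n → Set
  Locked e = root (u e) ≡ root (v e) × Cross colour e

  locked? : Decidable Locked
  locked? e = (root (u e) ≟ root (v e)) ×-dec cross? colour e

  locked-∈ : ∀ e → e ∈ A → Locked e
  locked-∈ e e∈A = All.lookup joined e∈A , All.lookup proper e∈A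

  -- The number of components: each contains exactly one vertex fixed by `root`.
  roots : ℕ
  roots = ∑ (λ w → ind (root w ≟ w)) (allFin n)

open Components

-- Updating the components when Avoider claims an edge.

singletons : Components {n} []
singletons = record
  { root = λ w → w ; colour = λ _ → true ; root-idem = λ _ → refl
  ; joined = [] ; proper = [] ; rigid = λ _ _ _ → refl }

roots-singletons : roots (singletons {n}) ≤ n
roots-singletons {n} = ≤-trans
  (∑-mono (λ w → ind-mono (w ≟ w) (yes refl) λ p → p) (allFin n))
  (≤-reflexive (trans (∑-one (allFin n)) (length-tabulate (λ i → i))))

add-locked : {e : Edge n} {A : List (Edge n)} (C : Components A) → Locked C e → Components (e ∷ A)
add-locked C (same , differ) = record
  { root = root C ; colour = colour C ; root-idem = root-idem C
  ; joined = same ∷ joined C ; proper = differ ∷ proper C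
  ; rigid = λ { c (_ ∷ pA) → rigid C c pA } }

-- By rigidity, a proper colouring of the enlarged graph would agree with `colour` at both ends of
-- `e` up to one common swap, but `colour` gives these ends the same colour.
odd-cycle : {e : Edge n} {A : List (Edge n)} (C : Components A) →
  root C (u e) ≡ root C (v e) → ¬ Cross (colour C) e → NonBipartite (e ∷ A)
odd-cycle {e = e} C same mono (c , ce ∷ cA) = mono λ eq → ce (xor-cancelʳ _ _ (colour C (u e)) (begin
  c (u e) xor colour C (u e)                     ≡⟨ rigid C c cA (u e) ⟩
  c (root C (u e)) xor colour C (root C (u e))   ≡⟨ cong (λ r → c r xor colour C r) same ⟩
  c (root C (v e)) xor colour C (root C (v e))   ≡⟨ rigid C c cA (v e) ⟨
  c (v e) xor colour C (v e)                     ≡⟨ cong (c (v e) xor_) eq ⟨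
  c (v e) xor colour C (u e)                     ∎))
  where
  open ≡-Reasoning
  xor-cancelʳ : ∀ a b x → a xor x ≡ b xor x → a ≡ b
  xor-cancelʳ true  true  _     _ = refl
  xor-cancelʳ false false _     _ = refl
  xor-cancelʳ true  false true  ()
  xor-cancelʳ true  false false ()
  xor-cancelʳ false true  true  ()
  xor-cancelʳ false true  false ()

module Merge {n} {A : List (Edge n)} (C : Components A) (e : Edge n)
  (apart : root C (u e) ≢ root C (v e)) where

  private
    ru rv : Fin n
    ru = root C (u e)
    rv = root C (v e)

    -- The component of `v e` is absorbed into that of `u e`. It is flipped exactly when the ends of
    -- `e` have equal colours, so that `e` becomes crossing.
    s : Bool
    s = not (colour C (u e) xor colour C (v e))

    root′ : Fin n → Fin n
    root′ w = if does (root C w ≟ rv) then ru else root C w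

    colour′ : Colouring n
    colour′ w = if does (root C w ≟ rv) then s xor colour C w else colour C w

    root-in : ∀ {w} → root C w ≡ rv → root′ w ≡ ru
    root-in {w} p rewrite dec-true (root C w ≟ rv) p = refl

    root-out : ∀ {w} → root C w ≢ rv → root′ w ≡ root C w
    root-out {w} p rewrite dec-false (root C w ≟ rv) p = refl

    colour-in : ∀ {w} → root C w ≡ rv → colour′ w ≡ s xor colour C w
    colour-in {w} p rewrite dec-true (root C w ≟ rv) p = refl

    colour-out : ∀ {w} → root C w ≢ rv → colour′ w ≡ colour C w
    colour-out {w} p rewrite dec-false (root C w ≟ rv) p = refl

    ru-out : root C ru ≢ rv
    ru-out p = apart (trans (sym (root-idem C (u e))) p)

    root-root-out : ∀ {w} → root C w ≢ rv → root C (root C w) ≢ rv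
    root-root-out p q = p (trans (sym (root-idem C _)) q)

    root′-idem : ∀ w → root′ (root′ w) ≡ root′ w
    root′-idem w with root C w ≟ rv
    ... | yes _ = trans (root-out ru-out) (root-idem C (u e))
    ... | no p  = trans (root-out (root-root-out p)) (root-idem C w)

    xor-injectiveˡ : ∀ a {x y} → a xor x ≡ a xor y → x ≡ y
    xor-injectiveˡ true  = not-injective
    xor-injectiveˡ false = λ p → p

    flipped : ∀ x y → x ≢ not (x xor y) xor y
    flipped true  true  ()
    flipped true  false ()
    flipped false true  ()
    flipped false false ()

  -- A merge relabels and flips whole components, so the two ends of an edge within one component
  -- are treated alike.
  keeps-locked : ∀ f → Locked C f → root′ (u f) ≡ root′ (v f) × Cross colour′ f
  keeps-locked f (same , differ) with root C (u f) ≟ rv | root C (v f) ≟ rv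
  ... | yes p | yes q = refl , λ eq → differ (xor-injectiveˡ s eq)
  ... | yes p | no ¬q = ⊥-elim (¬q (trans (sym same) p))
  ... | no ¬p | yes q = ⊥-elim (¬p (trans same q))
  ... | no _  | no _  = same , differ

  private
    xor-swap : ∀ a b x → a xor (b xor x) ≡ b xor (a xor x)
    xor-swap true  true  _ = refl
    xor-swap true  false _ = refl
    xor-swap false true  _ = refl
    xor-swap false false _ = refl

    across : ∀ a b x y → a ≢ b → not (x xor y) xor (b xor y) ≡ a xor x
    across true  true  _     _     ne = ⊥-elim (ne refl)
    across false false _     _     ne = ⊥-elim (ne refl)
    across true  false true  true  _  = refl
    across true  false true  false _  = refl
    across true  false false true  _  = refl
    across true  false false false _  = refl
    across false true  true  true  _  = refl
    across false true  true  false _  = refl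
    across false true  false true  _  = refl
    across false true  false false _  = refl

    -- On the absorbed component `c` differs from the old colouring by the swap seen at `v e`. Since
    -- `e` crosses under `c`, correcting by `s` turns this into the swap seen at `u e`.
    rigid′ : ∀ c → All (Cross c) (e ∷ A) → ∀ w →
      c w xor colour′ w ≡ c (root′ w) xor colour′ (root′ w)
    rigid′ c (ce ∷ cA) w with root C w ≟ rv
    ... | no p  = trans (rigid C c cA w) (cong (c (root C w) xor_) (sym (colour-out (root-root-out p))))
    ... | yes p = begin
      c w xor (s xor colour C w)       ≡⟨ xor-swap (c w) s (colour C w) ⟩
      s xor (c w xor colour C w)       ≡⟨ cong (s xor_) (rigid C c cA w) ⟩
      s xor D (root C w)               ≡⟨ cong (λ r → s xor D r) p ⟩
      s xor D rv                       ≡⟨ cong (s xor_) (rigid C c cA (v e)) ⟨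
      s xor D (v e)                    ≡⟨ across _ _ (colour C (u e)) (colour C (v e)) ce ⟩
      D (u e)                          ≡⟨ rigid C c cA (u e) ⟩
      c ru xor colour C ru             ≡⟨ cong (c ru xor_) (colour-out ru-out) ⟨
      c ru xor colour′ ru              ∎
      where
      open ≡-Reasoning
      D : Fin n → Bool
      D x = c x xor colour C x

  merged : Components (e ∷ A)
  merged = record
    { root = root′ ; colour = colour′ ; root-idem = root′-idem
    ; joined = trans (root-out apart) (sym (root-in refl))
        ∷ All.tabulate (λ {f} f∈A → proj₁ (keeps-locked f (locked-∈ C f f∈A)))
    ; proper = (λ eq → flipped _ _ (trans (sym (colour-out apart)) (trans eq (colour-in refl))))
        ∷ All.tabulate (λ {f} f∈A → proj₂ (keeps-locked f (locked-∈ C f f∈A)))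
    ; rigid = rigid′ }

  -- The vertex `rv` stops being a root, and no vertex becomes one.
  roots-merged : suc (roots merged) ≤ roots C
  roots-merged = ≤-trans (≤-reflexive (cong (_+ roots merged) (sym rv-once)))
    (∑-+≤ (λ w → ind-disjoint (rv ≟ w) (root′ w ≟ w) (root C w ≟ w)
      (λ { refl → root-idem C (v e) }) stays (λ { refl → rv-gone })) (allFin n))
    where
    rv-once : ∑ (λ w → ind (rv ≟ w)) (allFin n) ≡ 1
    rv-once = ∑-ind-single (rv ≟_) refl (λ p → p) (allFin⁺ n) (∈-allFin rv)

    stays : ∀ {w} → root′ w ≡ w → root C w ≡ w
    stays {w} p with root C w ≟ rv
    ... | no _  = p
    ... | yes _ = trans (cong (root C) (sym p)) (trans (root-idem C (u e)) p)

    rv-gone : root′ rv ≢ rv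
    rv-gone p = apart (trans (sym (root-in (root-idem C (v e)))) p)

-- Enforcer's strategy.

module Enforcer (n t : ℕ) (6n+4<n² : 6 * n + 4 < n * n) (t-large : n * n + 4 * n + 4 < 8 * t) where

  Taken : {A : List (Edge n)} → Components A → List (Edge n) → Edge n → Set
  Taken C B e = Locked C e × e ∈ B

  taken? : {A : List (Edge n)} (C : Components A) (B : List (Edge n)) → Decidable (Taken C B)
  taken? C B e = locked? C e ×-dec (e ∈? B)

  FreeLocked : {A : List (Edge n)} → Components A → List (Edge n) → Edge n → Set
  FreeLocked {A} C B e = Locked C e × e ∉ A × e ∉ B

  -- Each excess Avoider edge costs a component: Avoider can lead in the count of locked edges
  -- only by merging components.
  record Balanced {A B : List (Edge n)} (C : Components A) : Set where
    field
      disjoint : ∀ e → e ∈ A → e ∉ B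
      lead     : # (_∈? A) + roots C ≤ suc (# (taken? C B) + n)

  open Balanced

  -- Avoider's edges and the locked edges of Enforcer are disjoint parts of one cut, which has at
  -- most n^2/4 edges, and by `lead` the former outnumber the latter by at most n + 1.
  avoider-≤ : {A B : List (Edge n)} {C : Components A} → Balanced {B = B} C →
    8 * # (_∈? A) ≤ n * n + 4 * n + 4
  avoider-≤ {A} {B} {C} bal = begin
    8 * a                       ≡⟨ double a ⟩
    4 * a + 4 * a               ≤⟨ +-monoʳ-≤ (4 * a) (*-monoʳ-≤ 4 (≤-trans (m≤m+n a (roots C)) (lead bal))) ⟩
    4 * a + 4 * suc (b + n)     ≡⟨ regroup a b n ⟩
    4 * (a + b) + 4 * n + 4     ≤⟨ +-monoˡ-≤ 4 (+-monoˡ-≤ (4 * n) (*-monoʳ-≤ 4 in-cut)) ⟩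
    4 * # (cross? (colour C)) + 4 * n + 4  ≤⟨ +-monoˡ-≤ 4 (+-monoˡ-≤ (4 * n) (cross-count-≤ (colour C))) ⟩
    n * n + 4 * n + 4           ∎
    where
    open ≤-Reasoning
    a b : ℕ
    a = # (_∈? A)
    b = # (taken? C B)
    double : ∀ a → 8 * a ≡ 4 * a + 4 * a
    double = solve-∀
    regroup : ∀ a b n → 4 * a + 4 * (1 + (b + n)) ≡ 4 * (a + b) + 4 * n + 4
    regroup = solve-∀
    in-cut : a + b ≤ # (cross? (colour C))
    in-cut = #-disjoint (_∈? A) (taken? C B) (cross? (colour C))
      (λ e e∈A → proj₂ (locked-∈ C e e∈A)) (λ _ → proj₂ ∘ proj₁) (λ e e∈A p → disjoint bal e e∈A (proj₂ p))

  -- On a full board Avoider would own at least half of all edges, more than `avoider-≤` permits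
  -- once n^2 exceeds 6n + 4.
  free-edge : {A B : List (Edge n)} {C : Components A} → Balanced {B = B} C →
    # (_∈? B) ≤ # (_∈? A) → ∃ λ e → e ∉ A × e ∉ B
  free-edge {A} {B} bal b≤a with search (λ e → ¬? (e ∈? A) ×-dec ¬? (e ∈? B))
  ... | yes found = found
  ... | no none   = ⊥-elim (<⇒≱ 6n+4<n² (+-cancelˡ-≤ (n * n) _ _ (begin
    n * n + n * n            ≡⟨ cong₂ _+_ (sym (length-allEdges n)) (sym (length-allEdges n)) ⟩
    (2 * ℓ + n) + (2 * ℓ + n) ≡⟨ collect ℓ n ⟩
    4 * ℓ + 2 * n            ≤⟨ +-monoˡ-≤ (2 * n) (*-monoʳ-≤ 4 full) ⟩
    4 * (a + a) + 2 * n      ≡⟨ eight a n ⟩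
    8 * a + 2 * n            ≤⟨ +-monoˡ-≤ (2 * n) (avoider-≤ bal) ⟩
    n * n + 4 * n + 4 + 2 * n ≡⟨ total (n * n) n ⟩
    n * n + (6 * n + 4)      ∎)))
    where
    open ≤-Reasoning
    a ℓ : ℕ
    a = # (_∈? A)
    ℓ = length (allEdges n)
    collect : ∀ l n → (2 * l + n) + (2 * l + n) ≡ 4 * l + 2 * n
    collect = solve-∀
    eight : ∀ a n → 4 * (a + a) + 2 * n ≡ 8 * a + 2 * n
    eight = solve-∀
    total : ∀ s n → s + 4 * n + 4 + 2 * n ≡ s + (6 * n + 4)
    total = solve-∀
    claimed : ∀ e → e ∈ A ⊎ e ∈ B
    claimed e with e ∈? A | e ∈? B
    ... | yes p | _     = inj₁ p
    ... | no _  | yes q = inj₂ q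
    ... | no ¬p | no ¬q = ⊥-elim (none (e , ¬p , ¬q))
    full : ℓ ≤ a + a
    full = begin
      ℓ               ≡⟨ ∑-one (allEdges n) ⟨
      # {n} (λ _ → yes tt) ≤⟨ #-⊎ {n} (λ _ → yes tt) (_∈? A) (_∈? B) (λ e _ → claimed e) ⟩
      a + # (_∈? B)   ≤⟨ +-monoʳ-≤ a b≤a ⟩
      a + a           ∎

  module _ {A B : List (Edge n)} (C : Components A) {e : Edge n} (e∉A : e ∉ A) (e∉B : e ∉ B) where

    take : Balanced {B = B} C → Balanced {B = e ∷ B} C
    take bal = record
      { disjoint = λ { _ f∈A (here refl) → e∉A f∈A ; f f∈A (there f∈B) → disjoint bal f f∈A f∈B }
      ; lead = ≤-trans (lead bal) (s≤s (+-monoˡ-≤ n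
          (#-mono (taken? C B) (taken? C (e ∷ B)) λ { _ (l , f∈B) → l , there f∈B }))) }

    -- The claimed locked edge absorbs the slack of one in `lead`; the tight bound then pays for a
    -- locked edge claimed next by Avoider.
    take-locked : Locked C e → Balanced {B = B} C → # (_∈? A) + roots C ≤ # (taken? C (e ∷ B)) + n
    take-locked l bal = ≤-trans (lead bal) (+-monoˡ-≤ n
      (#-insert-≥ (taken? C (e ∷ B)) (taken? C B) e (l , here refl) (e∉B ∘ proj₂)
        λ { _ (l , f∈B) → l , there f∈B }))

    give-locked : (l : Locked C e) → Balanced {B = B} C →
      # (_∈? A) + roots C ≤ # (taken? C B) + n → Balanced {B = B} (add-locked C l)
    give-locked l bal tight = record
      { disjoint = λ { _ (here refl) → e∉B ; f (there f∈A) → disjoint bal f f∈A }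
      ; lead = ≤-trans (≤-reflexive (cong (_+ roots C) (#-∷ e∉A))) (s≤s tight) }

    -- The component lost in the merge pays for the new edge, and the locked edges of Enforcer stay
    -- locked.
    give-merging : (apart : root C (u e) ≢ root C (v e)) → Balanced {B = B} C →
      Balanced {B = B} (Merge.merged C e apart)
    give-merging apart bal = record
      { disjoint = λ { _ (here refl) → e∉B ; f (there f∈A) → disjoint bal f f∈A }
      ; lead = begin
          # (_∈? (e ∷ A)) + roots merged  ≡⟨ cong (_+ roots merged) (#-∷ e∉A) ⟩
          suc (# (_∈? A)) + roots merged  ≡⟨ +-suc (# (_∈? A)) (roots merged) ⟨
          # (_∈? A) + suc (roots merged)  ≤⟨ +-monoʳ-≤ (# (_∈? A)) roots-merged ⟩
          # (_∈? A) + roots C             ≤⟨ lead bal ⟩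
          suc (# (taken? C B) + n)        ≤⟨ s≤s (+-monoˡ-≤ n (#-mono (taken? C B) (taken? merged B)
                                               λ { f (l , f∈B) → keeps-locked f l , f∈B })) ⟩
          suc (# (taken? merged B) + n)   ∎ }
      where
      open ≤-Reasoning
      open Merge C e apart

  mutual

    -- The last premise is the invariant left by Enforcer: either the lead is tight, so Avoider may
    -- take one locked edge without breaking the balance, or no locked edge is free, so he must
    -- merge components or close an odd cycle. The bound on `t` makes the counter `k` reach zero
    -- only when Avoider holds at least `t` edges.
    avoider-turn : ∀ k {A B} (C : Components A) → Balanced {B = B} C →
      # (_∈? B) ≤ # (_∈? A) → t ≤ # (_∈? A) + k →
      (# (_∈? A) + roots C ≤ # (taken? C B) + n) ⊎ (∀ e → ¬ FreeLocked C B e) →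
      AvTurn n k A B
    -- Holding `t` edges in a balanced position contradicts `avoider-≤`.
    avoider-turn zero {A} C bal b≤a t≤ _ =
      ⊥-elim (<⇒≱ t-large (≤-trans (*-monoʳ-≤ 8 (subst (t ≤_) (+-identityʳ _) t≤)) (avoider-≤ bal)))
    avoider-turn (suc k) {A} {B} C bal b≤a t≤ threat =
      av-move (let e , e∉A , e∉B = free-edge bal b≤a in e , ∉⇒Free e∉A e∉B) λ e free →
        let e∉A , e∉B = Free⇒∉ free in respond e e∉A e∉B (locked? C e) (root C (u e) ≟ root C (v e)) threat
      where
      b<a : ∀ {e} → e ∉ A → suc (# (_∈? B)) ≤ # (_∈? (e ∷ A))
      b<a e∉A = ≤-trans (s≤s b≤a) (≤-reflexive (sym (#-∷ e∉A)))

      t≤′ : ∀ {e} → e ∉ A → t ≤ # (_∈? (e ∷ A)) + k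
      t≤′ e∉A = ≤-trans t≤ (≤-reflexive (trans (+-suc _ k) (cong (_+ k) (sym (#-∷ e∉A)))))

      respond : ∀ e → e ∉ A → e ∉ B → Dec (Locked C e) → Dec (root C (u e) ≡ root C (v e)) →
        (# (_∈? A) + roots C ≤ # (taken? C B) + n) ⊎ (∀ e → ¬ FreeLocked C B e) → EnTurn n k (e ∷ A) B
      respond e e∉A e∉B (yes l) _ (inj₁ tight) =
        enforcer-turn k (add-locked C l) (give-locked C e∉A e∉B l bal tight) (b<a e∉A) (t≤′ e∉A)
      respond e e∉A e∉B (yes l) _ (inj₂ none) = ⊥-elim (none e (l , e∉A , e∉B))
      respond e _ _ (no ¬l) (yes same) _ = en-lost (odd-cycle C same λ differ → ¬l (same , differ))
      respond e e∉A e∉B (no _) (no apart) _ =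
        enforcer-turn k (Merge.merged C e apart) (give-merging C e∉A e∉B apart bal) (b<a e∉A) (t≤′ e∉A)

    enforcer-turn : ∀ k {A B} (C : Components A) → Balanced {B = B} C →
      suc (# (_∈? B)) ≤ # (_∈? A) → t ≤ # (_∈? A) + k → EnTurn n k A B
    enforcer-turn k {A} {B} C bal b<a t≤ with search (λ e → locked? C e ×-dec ¬? (e ∈? A) ×-dec ¬? (e ∈? B))
    ... | yes (e , l , e∉A , e∉B) = en-move e (∉⇒Free e∉A e∉B)
          (avoider-turn k C (take C e∉A e∉B bal) (≤-trans (≤-reflexive (#-∷ e∉B)) b<a) t≤
            (inj₁ (take-locked C e∉A e∉B l bal)))
    -- No locked edge is free, and an arbitrary claim of Enforcer frees none, so the second
    -- alternative of the invariant holds.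
    ... | no none with e , e∉A , e∉B ← free-edge bal (<⇒≤ b<a) = en-move e (∉⇒Free e∉A e∉B)
          (avoider-turn k C (take C e∉A e∉B bal) (≤-trans (≤-reflexive (#-∷ e∉B)) b<a) t≤
            (inj₂ λ { f (l , f∉A , f∉B) → none (f , l , f∉A , f∉B ∘ there) }))

  enforcer-wins : EnforcerWinsWithin n t
  enforcer-wins = avoider-turn t singletons
    (record { disjoint = λ _ () ; lead = m≤n⇒m≤1+n start }) ≤-refl (m≤n+m t _) (inj₁ start)
    where
    start : # {n} (_∈? []) + roots (singletons {n}) ≤ # (taken? singletons []) + n
    start = ≤-trans (+-mono-≤ (#-∈-≤ {n} []) roots-singletons) (m≤n+m n _)

-- The constants in the two bounds.

halve : ∀ m → ∃ λ j → j + j ≤ m × m ≤ suc (j + j)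
halve zero          = 0 , z≤n , z≤n
halve (suc zero)    = 0 , z≤n , ≤-refl
halve (suc (suc m)) with j , a , b ← halve m =
  suc j , subst (_≤ suc (suc m)) (cong suc (sym (+-suc j j))) (s≤s (s≤s a))
        , subst (suc (suc m) ≤_) (cong (λ i → suc (suc i)) (sym (+-suc j j))) (s≤s (s≤s b))

-- The constants are the fractions p₁/q₁ and p₂/q₂, and both inequalities are multiplied by 8 and by
-- the denominator. The lower bound holds for every `t` within which Enforcer wins, and the upper
-- bound exhibits one such `t`.
theorem2 : ∃[ p₁ ] ∃[ q₁ ] ∃[ p₂ ] ∃[ q₂ ]
    (0 < p₁ × 0 < q₁ × 0 < p₂ × 0 < q₂ ×
    ∃[ N ] (∀ n → N ≤ n →
    (∀ t → EnforcerWinsWithin n t → q₁ * (n * n) + 8 * p₁ * n ≤ 8 * q₁ * t)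
    ×
    (∃[ t ] (8 * q₂ * t ≤ q₂ * (n * n) + 8 * p₂ * n × EnforcerWinsWithin n t))))
-- Rounding `j` down, the matching phase shows that n^2 + n - 6 is at most 8t, and n - 6 is at least
-- n/2 from n = 12 on; this gives the constant 1/16.
theorem2 = 1 , 16 , 1 , 1 , s≤s z≤n , s≤s z≤n , s≤s z≤n , s≤s z≤n , 12 , λ n 12≤n →
  lower n 12≤n , upper n 12≤n
  where
  lower : ∀ n → 12 ≤ n → ∀ t → EnforcerWinsWithin n t → 16 * (n * n) + 8 * 1 * n ≤ 8 * 16 * t
  -- With n = 12 + m, `j` is (n - 4)/2 rounded down, the largest value that `lower-bound` admits.
  lower n 12≤n t wins with m , refl ← m≤n⇒∃[o]m+o≡n 12≤n with j , j≤ , ≤j ← halve (8 + m) =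
    +-cancelʳ-≤ 32 _ _ (begin
      16 * (n * n) + 8 * 1 * n + 32              ≤⟨ m≤m+n _ (8 * m) ⟩
      16 * (n * n) + 8 * 1 * n + 32 + 8 * m      ≡⟨ collect (n * n) m ⟩
      16 * (n * n + (8 + m))                     ≤⟨ *-monoʳ-≤ 16 (+-monoʳ-≤ (n * n) ≤j) ⟩
      16 * (n * n + suc (j + j))                 ≡⟨ cong (16 *_) (+-suc (n * n) (j + j)) ⟩
      16 * suc (n * n + (j + j))                 ≤⟨ *-monoʳ-≤ 16 (s≤s (lower-bound j
                                                      (≤-trans (+-monoˡ-≤ 4 j≤) (≤-reflexive (+-comm (8 + m) 4))) wins)) ⟩
      16 * suc (8 * t + 1)                       ≡⟨ scale t ⟩
      8 * 16 * t + 32                            ∎)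
    where
    open ≤-Reasoning
    collect : ∀ s m → 16 * s + 8 * 1 * (12 + m) + 32 + 8 * m ≡ 16 * (s + (8 + m))
    collect = solve-∀
    scale : ∀ t → 16 * suc (8 * t + 1) ≡ 8 * 16 * t + 32
    scale = solve-∀

  upper : ∀ n → 12 ≤ n → ∃[ t ] (8 * 1 * t ≤ 1 * (n * n) + 8 * 1 * n × EnforcerWinsWithin n t)
  upper n 12≤n with m , refl ← m≤n⇒∃[o]m+o≡n 12≤n =
    -- Avoider can hold at most (n^2 + 4n + 4)/8 edges in a balanced position; adding all of `n` to
    -- the floor of n^2/8 exceeds this in spite of the rounding.
    q + n , t-small , Enforcer.enforcer-wins n (q + n) 6n+4<n² t-large
    where
    open ≤-Reasoning
    q : ℕ
    q = n * n / 8

    t-small : 8 * 1 * (q + n) ≤ 1 * (n * n) + 8 * 1 * n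
    t-small = begin
      8 * 1 * (q + n)          ≡⟨ expand q n ⟩
      q * 8 + 8 * 1 * n        ≤⟨ +-monoˡ-≤ (8 * 1 * n) (m/n*n≤m (n * n) 8) ⟩
      n * n + 8 * 1 * n        ≡⟨ cong (_+ 8 * 1 * n) (*-identityˡ (n * n)) ⟨
      1 * (n * n) + 8 * 1 * n  ∎
      where
      expand : ∀ q n → 8 * 1 * (q + n) ≡ q * 8 + 8 * 1 * n
      expand = solve-∀

    6n+4<n² : 6 * n + 4 < n * n
    6n+4<n² = subst (6 * n + 4 <_) (expand m) (m<m+n (6 * n + 4) (s≤s z≤n))
      where
      expand : ∀ m → 6 * (12 + m) + 4 + suc (67 + 18 * m + m * m) ≡ (12 + m) * (12 + m)
      expand = solve-∀

    t-large : n * n + 4 * n + 4 < 8 * (q + n)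
    t-large = begin-strict
      n * n + 4 * n + 4              ≡⟨ cong (λ s → s + 4 * n + 4) (m≡m%n+[m/n]*n (n * n) 8) ⟩
      n * n % 8 + q * 8 + 4 * n + 4  <⟨ +-monoˡ-< 4 (+-monoˡ-< (4 * n) (+-monoˡ-< (q * 8) (m%n<n (n * n) 8))) ⟩
      8 + q * 8 + 4 * n + 4          ≤⟨ m≤m+n _ (36 + 4 * m) ⟩
      8 + q * 8 + 4 * n + 4 + (36 + 4 * m) ≡⟨ collect q m ⟩
      8 * (q + n)                    ∎
      where
      collect : ∀ q m → 8 + q * 8 + 4 * (12 + m) + 4 + (36 + 4 * m) ≡ 8 * (q + (12 + m))
      collect = solve-∀
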